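{- Let $X$ be a term of $T_\Sigma$, let $\tilde x$ be a finite set (or tuple) of names, and let $\sigma$ be a well-sorted substitution. If $\tilde x\#\sigma$ and $(\mathrm n(X)\setminus\tilde x),X\Vdash\tilde x$, then $(\mathrm n(X\sigma)\setminus\tilde x),X\sigma\Vdash\tilde x$.
   Context: $\mathcal N$ is a countably infinite set of names. $T_\Sigma$ is the set of terms generated from the names by the nullary symbol $()$, the binary symbols pairing $(\cdot,\cdot)$, $\mathtt{enc}(\cdot,\cdot)$ and $\mathtt{enc}^{ -1}(\cdot,\cdot)$, and the unary symbols $\mathtt{eKey}(\cdot)$ and $\mathtt{dKey}(\cdot)$. $\mathrm n(X)$ is the set of names occurring in $X$. A term has sort $\mathtt{impl}$ iff it has no subterm of the form $\mathtt{enc}^{ -1}(N_1,N_2)$; in particular names have sort $\mathtt{impl}$. A well-sorted substitution $\sigma=[\tilde y:=\tilde L]$ consists of a finite tuple $\tilde y$ of distinct names and an equally long tuple $\tilde L$ of terms of sort $\mathtt{impl}$. $\tilde x\#\sigma$ means that no name in $\tilde x$ is in $\tilde y$ or occurs in $\tilde L$. Its action on terms is: $x\sigma=L_i$ if $x=y_i$, and $x\sigma=x$ if $x\notin\tilde y$; $\mathtt{enc}^{ -1}(M_1,M_2)\sigma=\mathtt{enc}(M_1\sigma,\mathtt{eKey}(N))$ if $M_2\sigma=\mathtt{dKey}(N)$ for some $N$; and $f(M_1,\dots,M_n)\sigma=f(M_1\sigma,\dots,M_n\sigma)$ in all other cases. Dolev–Yao derivability $\tilde M\Vdash\tilde N$,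 between finite sequences of terms regarded up to reordering (finite sets of names are regarded as such sequences), is the smallest relation closed under: - True: $\tilde M\Vdash{}$ (empty right-hand side). - Id: $\tilde M,N\Vdash\tilde L$ implies $\tilde M,N\Vdash N,\tilde L$. - Copy: $\tilde M\Vdash N,\tilde L$ implies $\tilde M\Vdash N,N,\tilde L$. - Nil: $\tilde M\Vdash\tilde L$ implies $\tilde M\Vdash(),\tilde L$. - Pair: $\tilde M\Vdash N,N',\tilde L$ implies $\tilde M\Vdash(N,N'),\tilde L$. - Split: $\tilde M,N,N'\Vdash\tilde L$ implies $\tilde M,(N,N')\Vdash\tilde L$. - Key: $\tilde M\Vdash N,\tilde L$ implies $\tilde M\Vdash f(N),\tilde L$ for $f\in\{\mathtt{eKey},\mathtt{dKey}\}$. - Encrypt: $\tilde M\Vdash N,N',\tilde L$ implies $\tilde M\Vdash\mathtt{enc}(N,N'),\tilde L$. - Decrypt: $\tilde M\Vdash N'$ and $\tilde M,N\Vdash\tilde L$ imply $\tilde M,\mathtt{enc}^{ -1}(N,N')\Vdash\tilde L$. - Unencrypt: $\tilde M\Vdash\mathtt{dKey}(N')$ and $\tilde M,N\Vdash\tilde L$ imply $\tilde M,\mathtt{enc}(N,\mathtt{eKey}(N'))\Vdash\tilde L$. -}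

module Defs where

open import Data.List.Base using (List; []; _∷_; _++_; [_]; map; filter; deduplicate)
open import Data.List.Membership.DecPropositional as DecMembership using ()
open import Data.List.Membership.Propositional using (_∉_)
open import Data.List.Relation.Binary.Permutation.Propositional using (_↭_)
open import Data.List.Relation.Unary.All using (All)
open import Data.Nat.Base using (ℕ)
open import Data.Nat.Properties using (_≟_)
open import Data.Product.Base using (_×_)
open import Data.Vec.Base using (Vec; []; _∷_)
import Data.Vec.Membership.Propositional as Vec
import Data.Vec.Relation.Unary.All as Vec
import Data.Vec.Relation.Unary.Unique.Propositional as Vec
open import Relation.Nullary.Decidable using (yes; no)
open import Relation.Nullary.Negation using (¬_)

-- Only countable infinity of the set of names matters.
Name : Set
Name = ℕ

data Term : Set where
  name  : Name → Term
  unit  : Term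
  pair  : Term → Term → Term
  enc   : Term → Term → Term
  enc⁻¹ : Term → Term → Term
  eKey  : Term → Term
  dKey  : Term → Term

infix 4 _⊑_ _#_ _⊩_
infixl 8 _∖_
infixl 9 _⟪_⟫

data _⊑_ (S : Term) : Term → Set where
  here   : S ⊑ S
  pairˡ  : ∀ {M N} → S ⊑ M → S ⊑ pair M N
  pairʳ  : ∀ {M N} → S ⊑ N → S ⊑ pair M N
  encˡ   : ∀ {M N} → S ⊑ M → S ⊑ enc M N
  encʳ   : ∀ {M N} → S ⊑ N → S ⊑ enc M N
  enc⁻¹ˡ : ∀ {M N} → S ⊑ M → S ⊑ enc⁻¹ M N
  enc⁻¹ʳ : ∀ {M N} → S ⊑ N → S ⊑ enc⁻¹ M N
  eKey   : ∀ {M} → S ⊑ M → S ⊑ eKey M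
  dKey   : ∀ {M} → S ⊑ M → S ⊑ dKey M

Impl : Term → Set
Impl M = ∀ N₁ N₂ → ¬ (enc⁻¹ N₁ N₂ ⊑ M)

occurrences : Term → List Name
occurrences (name x)    = [ x ]
occurrences unit        = []
occurrences (pair M N)  = occurrences M ++ occurrences N
occurrences (enc M N)   = occurrences M ++ occurrences N
occurrences (enc⁻¹ M N) = occurrences M ++ occurrences N
occurrences (eKey M)    = occurrences M
occurrences (dKey M)    = occurrences M

-- A finite set of names is represented by a duplicate-free list.
n : Term → List Name
n X = deduplicate _≟_ (occurrences X)

_∖_ : List Name → List Name → List Name
xs ∖ ys = filter (λ x → x ∉? ys) xs
  where open DecMembership _≟_ using (_∉?_)

record Subst : Set where
  field
    {size}   : ℕ
    dom      : Vec Name size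
    img      : Vec Term size
    distinct : Vec.Unique dom
    impl     : Vec.All Impl img

open Subst public

_#_ : List Name → Subst → Set
xs # σ = All (λ x → x Vec.∉ dom σ × Vec.All (λ L → x ∉ n L) (img σ)) xs

substName : ∀ {k} → Vec Name k → Vec Term k → Name → Term
substName []       []       x = name x
substName (y ∷ ys) (L ∷ Ls) x with x ≟ y
... | yes _ = L
... | no  _ = substName ys Ls x

-- The value of enc⁻¹(M₁,M₂)σ, given M₁σ and M₂σ.
contract : Term → Term → Term
contract M (dKey N) = enc M (eKey N)
contract M N        = enc⁻¹ M N

_⟪_⟫ : Term → Subst → Term
name x    ⟪ σ ⟫ = substName (dom σ) (img σ) x
unit      ⟪ σ ⟫ = unit
pair M N  ⟪ σ ⟫ = pair (M ⟪ σ ⟫) (N ⟪ σ ⟫)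
enc M N   ⟪ σ ⟫ = enc (M ⟪ σ ⟫) (N ⟪ σ ⟫)
enc⁻¹ M N ⟪ σ ⟫ = contract (M ⟪ σ ⟫) (N ⟪ σ ⟫)
eKey M    ⟪ σ ⟫ = eKey (M ⟪ σ ⟫)
dKey M    ⟪ σ ⟫ = dKey (M ⟪ σ ⟫)

-- Dolev–Yao derivability.  Sequences are taken up to reordering, which is
-- rendered by the additional rule `exchange`.
data _⊩_ : List Term → List Term → Set where
  exchange  : ∀ {Ms Ms′ Ls Ls′} → Ms ↭ Ms′ → Ls ↭ Ls′ → Ms ⊩ Ls → Ms′ ⊩ Ls′
  true      : ∀ {Ms} → Ms ⊩ []
  id        : ∀ {Ms N Ls} → N ∷ Ms ⊩ Ls → N ∷ Ms ⊩ N ∷ Ls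
  copy      : ∀ {Ms N Ls} → Ms ⊩ N ∷ Ls → Ms ⊩ N ∷ N ∷ Ls
  nil       : ∀ {Ms Ls} → Ms ⊩ Ls → Ms ⊩ unit ∷ Ls
  pair      : ∀ {Ms N N′ Ls} → Ms ⊩ N ∷ N′ ∷ Ls → Ms ⊩ pair N N′ ∷ Ls
  split     : ∀ {Ms N N′ Ls} → N ∷ N′ ∷ Ms ⊩ Ls → pair N N′ ∷ Ms ⊩ Ls
  eKey      : ∀ {Ms N Ls} → Ms ⊩ N ∷ Ls → Ms ⊩ eKey N ∷ Ls
  dKey      : ∀ {Ms N Ls} → Ms ⊩ N ∷ Ls → Ms ⊩ dKey N ∷ Ls
  encrypt   : ∀ {Ms N N′ Ls} → Ms ⊩ N ∷ N′ ∷ Ls → Ms ⊩ enc N N′ ∷ Ls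
  decrypt   : ∀ {Ms N N′ Ls} → Ms ⊩ [ N′ ] → N ∷ Ms ⊩ Ls → enc⁻¹ N N′ ∷ Ms ⊩ Ls
  unencrypt : ∀ {Ms N N′ Ls} → Ms ⊩ [ dKey N′ ] → N ∷ Ms ⊩ Ls →
              enc N (eKey N′) ∷ Ms ⊩ Ls

{-# OPTIONS --safe #-}
module Submission where

-- Derivability is stable under substitution: applying σ to every term of a
-- derivation of Ms ⊩ Ls yields a derivation of Msσ ⊩ Lsσ (`⊩-subst`).  Only
-- `decrypt` needs thought: if the key becomes dKey N, the substituted
-- ciphertext contracts to enc(M, eKey N), and `unencrypt` opens it with the
-- very key that the derivation provides.
--
-- As the names xs are fixed by σ, the hypothesis thus turns into
-- (n(X) ∖ xs)σ , Xσ ⊩ xs.  It remains to trade the terms (n(X) ∖ xs)σ for the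
-- names n(Xσ) ∖ xs.  Each of these terms has sort impl, and its names occur in
-- Xσ and avoid xs, so the rules for right-hand sides compose it from n(Xσ) ∖ xs
-- (`image-composed`, `compose`).  Hypotheses composed from names can be erased from a
-- derivation once the names are available (`⊩-erase`): taking such a hypothesis
-- apart again yields composed terms, and where it is used as a whole it can be
-- recomposed.

open import Data.List.Base using (List; []; _∷_; _++_; [_]; map)
open import Data.List.Membership.DecPropositional as DecMembership using ()
open import Data.List.Membership.Propositional using (_∈_; _∉_)
open import Data.List.Membership.Propositional.Properties
  using (∈-++⁻; ∈-++⁺ˡ; ∈-++⁺ʳ; ∈-filter⁺; ∈-filter⁻; ∈-deduplicate⁺; ∈-deduplicate⁻; ∈-map⁺; ∈-∃++)
open import Data.List.Relation.Binary.Permutation.Propositional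
  using (_↭_; refl; prep; swap; trans; ↭-refl; ↭-sym)
open import Data.List.Relation.Binary.Permutation.Propositional.Properties
  using (map⁺; ++⁺ʳ; ++-comm; shift)
open import Data.List.Relation.Unary.All as All using ([]; _∷_)
open import Data.List.Relation.Unary.Any using (here; there)
open import Data.Nat.Properties using (_≟_)
open import Data.Product.Base using (_×_; _,_; proj₂; ∃-syntax)
open import Data.Sum.Base using (inj₁; inj₂)
open import Data.Vec.Base using (Vec; []; _∷_)
import Data.Vec.Membership.Propositional as Vec
import Data.Vec.Relation.Unary.All as Vec
import Data.Vec.Relation.Unary.Any as VecAny
open import Function.Base using (_∘_)
open import Relation.Binary.PropositionalEquality using (_≡_; refl; sym; cong₂; subst)
open import Relation.Nullary.Decidable using (yes; no)
open import Relation.Nullary.Negation using (contradiction)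

open import Defs

open DecMembership _≟_ using (_∉?_)

decrypt-contract : ∀ {Ms Ls} M N → Ms ⊩ [ N ] → M ∷ Ms ⊩ Ls → contract M N ∷ Ms ⊩ Ls
decrypt-contract M (name _)    k d = decrypt k d
decrypt-contract M unit        k d = decrypt k d
decrypt-contract M (pair _ _)  k d = decrypt k d
decrypt-contract M (enc _ _)   k d = decrypt k d
decrypt-contract M (enc⁻¹ _ _) k d = decrypt k d
decrypt-contract M (eKey _)    k d = decrypt k d
decrypt-contract M (dKey _)    k d = unencrypt k d

⊩-subst : ∀ {Ms Ls} σ → Ms ⊩ Ls → map (_⟪ σ ⟫) Ms ⊩ map (_⟪ σ ⟫) Ls
⊩-subst σ (exchange p q d) = exchange (map⁺ _ p) (map⁺ _ q) (⊩-subst σ d)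
⊩-subst σ true             = true
⊩-subst σ (id d)           = id (⊩-subst σ d)
⊩-subst σ (copy d)         = copy (⊩-subst σ d)
⊩-subst σ (nil d)          = nil (⊩-subst σ d)
⊩-subst σ (pair d)         = pair (⊩-subst σ d)
⊩-subst σ (split d)        = split (⊩-subst σ d)
⊩-subst σ (eKey d)         = eKey (⊩-subst σ d)
⊩-subst σ (dKey d)         = dKey (⊩-subst σ d)
⊩-subst σ (encrypt d)      = encrypt (⊩-subst σ d)
⊩-subst σ (decrypt k d)    = decrypt-contract _ _ (⊩-subst σ k) (⊩-subst σ d)
⊩-subst σ (unencrypt k d)  = unencrypt (⊩-subst σ k) (⊩-subst σ d)

id-∈ : ∀ {Ms N Ls} → N ∈ Ms → Ms ⊩ Ls → Ms ⊩ N ∷ Ls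
id-∈ {N = N} N∈Ms d with ∈-∃++ N∈Ms
... | Ms₁ , Ms₂ , refl =
  exchange (↭-sym (shift N Ms₁ Ms₂)) ↭-refl (id (exchange (shift N Ms₁ Ms₂) ↭-refl d))

-- The terms built from the names in Ks by constructors other than enc⁻¹.
data Composed (Ks : List Term) : Term → Set where
  name : ∀ {x} → name x ∈ Ks → Composed Ks (name x)
  unit : Composed Ks unit
  pair : ∀ {M N} → Composed Ks M → Composed Ks N → Composed Ks (pair M N)
  enc  : ∀ {M N} → Composed Ks M → Composed Ks N → Composed Ks (enc M N)
  eKey : ∀ {M} → Composed Ks M → Composed Ks (eKey M)
  dKey : ∀ {M} → Composed Ks M → Composed Ks (dKey M)

impl⇒composed : ∀ {Ks} M → Impl M → (∀ {z} → z ∈ occurrences M → name z ∈ Ks) → Composed Ks M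
impl⇒composed (name x)    i o = name (o (here refl))
impl⇒composed unit        i o = unit
impl⇒composed (pair M N)  i o =
  pair (impl⇒composed M (λ _ _ → i _ _ ∘ pairˡ) (o ∘ ∈-++⁺ˡ))
       (impl⇒composed N (λ _ _ → i _ _ ∘ pairʳ) (o ∘ ∈-++⁺ʳ (occurrences M)))
impl⇒composed (enc M N)   i o =
  enc (impl⇒composed M (λ _ _ → i _ _ ∘ encˡ) (o ∘ ∈-++⁺ˡ))
      (impl⇒composed N (λ _ _ → i _ _ ∘ encʳ) (o ∘ ∈-++⁺ʳ (occurrences M)))
impl⇒composed (enc⁻¹ M N) i o = contradiction here (i M N)
impl⇒composed (eKey M)    i o = eKey (impl⇒composed M (λ _ _ → i _ _ ∘ eKey) o)
impl⇒composed (dKey M)    i o = dKey (impl⇒composed M (λ _ _ → i _ _ ∘ dKey) o)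

compose : ∀ {Ks M Ls} Ms → Composed Ks M → Ms ++ Ks ⊩ Ls → Ms ++ Ks ⊩ M ∷ Ls
compose Ms (name x∈Ks) d = id-∈ (∈-++⁺ʳ Ms x∈Ks) d
compose Ms unit        d = nil d
compose Ms (pair c c′) d = pair (compose Ms c (compose Ms c′ d))
compose Ms (enc c c′)  d = encrypt (compose Ms c (compose Ms c′ d))
compose Ms (eKey c)    d = eKey (compose Ms c d)
compose Ms (dKey c)    d = dKey (compose Ms c d)

-- Erasure Ks Ms Ms′: Ms′ arises from Ms by deleting some terms, all of them
-- composed from Ks.
data Erasure (Ks : List Term) : List Term → List Term → Set where
  []    : Erasure Ks [] []
  keep  : ∀ {M Ms Ms′} → Erasure Ks Ms Ms′ → Erasure Ks (M ∷ Ms) (M ∷ Ms′)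
  erase : ∀ {M Ms Ms′} → Composed Ks M → Erasure Ks Ms Ms′ → Erasure Ks (M ∷ Ms) Ms′

Erasure-↭ : ∀ {Ks Ms Ns Ns′} → Ms ↭ Ns → Erasure Ks Ns Ns′ →
            ∃[ Ms′ ] Erasure Ks Ms Ms′ × Ms′ ↭ Ns′
Erasure-↭ refl         e         = _ , e , ↭-refl
Erasure-↭ (prep x p)   (keep e)  with Erasure-↭ p e
... | _ , e′ , p′ = _ , keep e′ , prep x p′
Erasure-↭ (prep x p)   (erase c e) with Erasure-↭ p e
... | _ , e′ , p′ = _ , erase c e′ , p′
Erasure-↭ (swap x y p) (keep (keep e)) with Erasure-↭ p e
... | _ , e′ , p′ = _ , keep (keep e′) , swap x y p′
Erasure-↭ (swap x y p) (keep (erase c e)) with Erasure-↭ p e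
... | _ , e′ , p′ = _ , erase c (keep e′) , prep y p′
Erasure-↭ (swap x y p) (erase c (keep e)) with Erasure-↭ p e
... | _ , e′ , p′ = _ , keep (erase c e′) , prep x p′
Erasure-↭ (swap x y p) (erase c (erase c′ e)) with Erasure-↭ p e
... | _ , e′ , p′ = _ , erase c′ (erase c e′) , p′
Erasure-↭ (trans p q)  e with Erasure-↭ q e
... | _ , e′ , q′ with Erasure-↭ p e′
... | _ , e″ , p′ = _ , e″ , trans p′ q′

-- A cut for composed hypotheses.  The rules that open a hypothesis are replayed
-- on a kept one; on an erased one they merely replace it by parts of it, which are
-- composed and hence erased too.  An erased ciphertext needs no key, and none is
-- of the form enc⁻¹(N, N′).
⊩-erase : ∀ {Ks Ms Ms′ Ls} → Erasure Ks Ms Ms′ → Ms ⊩ Ls → Ms′ ++ Ks ⊩ Ls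
⊩-erase {Ks} e (exchange p q d) with Erasure-↭ p e
... | _ , e′ , p′ = exchange (++⁺ʳ Ks p′) q (⊩-erase e′ d)
⊩-erase e           true        = true
⊩-erase (keep e)    (id d)      = id (⊩-erase (keep e) d)
⊩-erase (erase c e) (id d)      = compose _ c (⊩-erase (erase c e) d)
⊩-erase e           (copy d)    = copy (⊩-erase e d)
⊩-erase e           (nil d)     = nil (⊩-erase e d)
⊩-erase e           (pair d)    = pair (⊩-erase e d)
⊩-erase (keep e)    (split d)   = split (⊩-erase (keep (keep e)) d)
⊩-erase (erase (pair c c′) e) (split d) = ⊩-erase (erase c (erase c′ e)) d
⊩-erase e           (eKey d)    = eKey (⊩-erase e d)
⊩-erase e           (dKey d)    = dKey (⊩-erase e d)
⊩-erase e           (encrypt d) = encrypt (⊩-erase e d)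
⊩-erase (keep e)    (decrypt k d)   = decrypt (⊩-erase e k) (⊩-erase (keep e) d)
⊩-erase (keep e)    (unencrypt k d) = unencrypt (⊩-erase e k) (⊩-erase (keep e) d)
⊩-erase (erase (enc c _) e) (unencrypt _ d) = ⊩-erase (erase c e) d

-- Contraction trades enc⁻¹ and dKey for enc and eKey and so keeps all names.
occurrences-contract : ∀ M N → occurrences (contract M N) ≡ occurrences M ++ occurrences N
occurrences-contract M (name _)    = refl
occurrences-contract M unit        = refl
occurrences-contract M (pair _ _)  = refl
occurrences-contract M (enc _ _)   = refl
occurrences-contract M (enc⁻¹ _ _) = refl
occurrences-contract M (eKey _)    = refl
occurrences-contract M (dKey _)    = refl

occurrences-subst : ∀ X σ {y z} → y ∈ occurrences X → z ∈ occurrences (name y ⟪ σ ⟫) →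
                    z ∈ occurrences (X ⟪ σ ⟫)
occurrences-subst₂ : ∀ M N σ {y z} → y ∈ occurrences M ++ occurrences N →
                     z ∈ occurrences (name y ⟪ σ ⟫) →
                     z ∈ occurrences (M ⟪ σ ⟫) ++ occurrences (N ⟪ σ ⟫)

occurrences-subst (name _)    σ (here refl) z∈ = z∈
occurrences-subst (pair M N)  σ y∈ z∈ = occurrences-subst₂ M N σ y∈ z∈
occurrences-subst (enc M N)   σ y∈ z∈ = occurrences-subst₂ M N σ y∈ z∈
occurrences-subst (enc⁻¹ M N) σ y∈ z∈ =
  subst (_ ∈_) (sym (occurrences-contract (M ⟪ σ ⟫) (N ⟪ σ ⟫))) (occurrences-subst₂ M N σ y∈ z∈)
occurrences-subst (eKey M)    σ y∈ z∈ = occurrences-subst M σ y∈ z∈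
occurrences-subst (dKey M)    σ y∈ z∈ = occurrences-subst M σ y∈ z∈

occurrences-subst₂ M N σ y∈ z∈ with ∈-++⁻ (occurrences M) y∈
... | inj₁ y∈M = ∈-++⁺ˡ (occurrences-subst M σ y∈M z∈)
... | inj₂ y∈N = ∈-++⁺ʳ (occurrences (M ⟪ σ ⟫)) (occurrences-subst N σ y∈N z∈)

substName-∉ : ∀ {k} (ys : Vec Name k) Ls {x} → x Vec.∉ ys → substName ys Ls x ≡ name x
substName-∉ []       []       x∉ = refl
substName-∉ (y ∷ ys) (L ∷ Ls) {x} x∉ with x ≟ y
... | yes x≡y = contradiction (VecAny.here x≡y) x∉
... | no  _   = substName-∉ ys Ls (x∉ ∘ VecAny.there)

-- A property shared by all terms L of the substitution and by the unsubstituted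
-- name holds for the image of the name.
substName-elim : ∀ {k} (P : Term → Set) (ys : Vec Name k) {Ls x} →
                 P (name x) → Vec.All P Ls → P (substName ys Ls x)
substName-elim P []       p Vec.[]               = p
substName-elim P (y ∷ ys) {x = x} p (q Vec.∷ qs) with x ≟ y
... | yes _ = q
... | no  _ = substName-elim P ys p qs

impl-image : ∀ σ y → Impl (name y ⟪ σ ⟫)
impl-image σ y = substName-elim Impl (dom σ) (λ _ _ ()) (impl σ)

-- Names of xs, being fresh for σ, do not occur in the image of a name outside xs.
fresh-image : ∀ {xs} σ {y z} → xs # σ → y ∉ xs → z ∈ occurrences (name y ⟪ σ ⟫) → z ∉ xs
fresh-image {xs} σ {y} {z} xs#σ y∉xs z∈ z∈xs =
  substName-elim (λ L → z ∉ n L) (dom σ) z∉y (proj₂ (All.lookup xs#σ z∈xs)) (∈-deduplicate⁺ _≟_ z∈)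
  where
  z∉y : z ∉ [ y ]
  z∉y (here refl) = y∉xs z∈xs

image-composed : ∀ X xs σ → xs # σ → ∀ {y} → y ∈ n X ∖ xs →
                 Composed (map name (n (X ⟪ σ ⟫) ∖ xs)) (name y ⟪ σ ⟫)
image-composed X xs σ xs#σ {y} y∈ with ∈-filter⁻ (_∉? xs) {xs = n X} y∈
... | y∈X , y∉xs = impl⇒composed (name y ⟪ σ ⟫) (impl-image σ y) λ z∈ →
  ∈-map⁺ name (∈-filter⁺ (_∉? xs)
    (∈-deduplicate⁺ _≟_ (occurrences-subst X σ (∈-deduplicate⁻ _≟_ (occurrences X) y∈X) z∈))
    (fresh-image σ xs#σ y∉xs z∈))

map-subst-fresh : ∀ {xs} σ → xs # σ → map (_⟪ σ ⟫) (map name xs) ≡ map name xs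
map-subst-fresh σ []                = refl
map-subst-fresh σ ((x∉dom , _) ∷ f) = cong₂ _∷_ (substName-∉ (dom σ) (img σ) x∉dom) (map-subst-fresh σ f)

erase-names : ∀ {Ks} σ ys M → (∀ {y} → y ∈ ys → Composed Ks (name y ⟪ σ ⟫)) →
              Erasure Ks (map (_⟪ σ ⟫) (map name ys ++ [ M ])) [ M ⟪ σ ⟫ ]
erase-names σ []       M c = keep []
erase-names σ (y ∷ ys) M c = erase (c (here refl)) (erase-names σ ys M (c ∘ there))

lemma5p3 : ∀ (X : Term) (xs : List Name) (σ : Subst) → xs # σ →
    map name (n X ∖ xs) ++ [ X ] ⊩ map name xs →
    map name (n (X ⟪ σ ⟫) ∖ xs) ++ [ X ⟪ σ ⟫ ] ⊩ map name xs
lemma5p3 X xs σ xs#σ d =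
  exchange (++-comm [ X ⟪ σ ⟫ ] Ks) ↭-refl
    (⊩-erase (erase-names σ (n X ∖ xs) X (image-composed X xs σ xs#σ))
      (subst (map (_⟪ σ ⟫) Ms ⊩_) (map-subst-fresh σ xs#σ) (⊩-subst σ d)))
  where
  Ks = map name (n (X ⟪ σ ⟫) ∖ xs)
  Ms = map name (n X ∖ xs) ++ [ X ]
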